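{- The complement of the positive range is $$\mathbb{Z}_{>0}\setminus\mathcal{H}^+=\bigcup_{n\ge3}\{H(n)+1,\ldots,H(n+1)-1\},$$ where an interval $\{H(n)+1,\ldots,H(n+1)-1\}$ is understood to be empty when $H(n+1)=H(n)+1$. The intervals in this union are pairwise disjoint.
   Context: $p(n)$ denotes the number of (unrestricted) partitions of the positive integer $n$, and $H(n):=p(n)-n$. The positive range is $\mathcal{H}^+:=\{H(n):n\ge 4\}$. $\{a,\ldots,b\}$ denotes the set of integers $m$ with $a\le m\le b$. -}

module Defs where

open import Data.Integer.Base as ℤ using (ℤ; +_; 0ℤ; 1ℤ)
open import Data.List.Base
  using (List; []; _∷_; cartesianProductWith; filter; length; map; upTo)
open import Data.List.Membership.Propositional using (_∈_)
open import Data.List.Membership.Propositional.Properties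
  using (∈-cartesianProductWith⁺; ∈-cartesianProductWith⁻; ∈-filter⁺; ∈-filter⁻;
         ∈-map⁺; ∈-upTo⁺)
open import Data.List.Properties using (∷-injective)
open import Data.List.Relation.Unary.All as All using (All; []; _∷_; all?)
open import Data.List.Relation.Unary.All.Properties using (¬Any⇒All¬)
open import Data.List.Relation.Unary.AllPairs using ([]; _∷_)
open import Data.List.Relation.Unary.Any using (here; there)
open import Data.List.Relation.Unary.Linked using (Linked; linked?)
open import Data.List.Relation.Unary.Unique.Propositional using (Unique)
import Data.List.Relation.Unary.Unique.Propositional.Properties as Unique
open import Data.Nat.Base
  using (ℕ; zero; suc; _≤_; _≥_; _>_; z≤n; s≤s)
open import Data.Nat.ListAction using (sum)
open import Data.Nat.Properties
  using (_≟_; _≥?_; _>?_; ≤-trans; m≤m+n; m≤n+m; +-mono-≤; suc-injective)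
open import Data.Product.Base using (_×_; _,_; proj₂; ∃-syntax)
open import Function.Base using (_∘_)
open import Function.Bundles using (_⇔_; mk⇔)
open import Level using (0ℓ)
open import Relation.Binary.PropositionalEquality using (_≡_; refl)
open import Relation.Nullary.Decidable using (_×-dec_)
open import Relation.Unary using (Pred; Decidable)

IsPartition : ℕ → Pred (List ℕ) 0ℓ
IsPartition n xs = Linked _≥_ xs × All (_> 0) xs × sum xs ≡ n

isPartition? : ∀ n → Decidable (IsPartition n)
isPartition? n xs = linked? _≥?_ xs ×-dec all? (_>? 0) xs ×-dec (sum xs ≟ n)

-- All lists of length at most l with entries in {1,…,b}.
boundedLists : (b l : ℕ) → List (List ℕ)
boundedLists b zero    = [] ∷ []
boundedLists b (suc l) =
  [] ∷ cartesianProductWith _∷_ (map suc (upTo b)) (boundedLists b l)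

-- A partition of n has at most n parts, each at most n, so none is missed;
-- `partitions-unique` and `∈-partitions` below show that each partition of n
-- is listed exactly once.
partitions : ℕ → List (List ℕ)
partitions n = filter (isPartition? n) (boundedLists n n)

p : ℕ → ℕ
p n = length (partitions n)

H : ℕ → ℤ
H n = + p n ℤ.- + n

ℤ>0 : Pred ℤ 0ℓ
ℤ>0 m = 0ℤ ℤ.< m

ℋ⁺ : Pred ℤ 0ℓ
ℋ⁺ m = ∃[ n ] (n ≥ 4 × m ≡ H n)

-- The set {a,…,b}, which is empty when b < a.
⟦_⋯_⟧ : ℤ → ℤ → Pred ℤ 0ℓ
⟦ a ⋯ b ⟧ m = a ℤ.≤ m × m ℤ.≤ b

gap : ℕ → Pred ℤ 0ℓ
gap n = ⟦ H n ℤ.+ 1ℤ ⋯ H (suc n) ℤ.- 1ℤ ⟧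

boundedLists-unique : ∀ b l → Unique (boundedLists b l)
boundedLists-unique b zero    = [] ∷ []
boundedLists-unique b (suc l) =
  ¬Any⇒All¬ _ []∉ ∷
  Unique.cartesianProductWith⁺ _∷_ ∷-injective
    (Unique.map⁺ suc-injective (Unique.upTo⁺ b)) (boundedLists-unique b l)
  where
  []∉ : _
  []∉ []∈ with ∈-cartesianProductWith⁻ _∷_ (map suc (upTo b)) (boundedLists b l) []∈
  ... | _ , _ , _ , _ , ()

∈-boundedLists : ∀ {b l xs} → All (_> 0) xs → All (_≤ b) xs → length xs ≤ l →
                 xs ∈ boundedLists b l
∈-boundedLists {l = zero}  []           []         _         = here refl
∈-boundedLists {l = suc l} []           []         _         = here refl
∈-boundedLists {l = suc l} (s≤s _ ∷ ps) (x≤b ∷ bs) (s≤s |xs|≤l) =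
  there (∈-cartesianProductWith⁺ _∷_ (∈-map⁺ suc (∈-upTo⁺ x≤b))
                                     (∈-boundedLists ps bs |xs|≤l))

parts≤sum : ∀ xs → All (_≤ sum xs) xs
parts≤sum []       = []
parts≤sum (x ∷ xs) =
  m≤m+n x (sum xs) ∷ All.map (λ y≤ → ≤-trans y≤ (m≤n+m (sum xs) x)) (parts≤sum xs)

length≤sum : ∀ {xs} → All (_> 0) xs → length xs ≤ sum xs
length≤sum []         = z≤n
length≤sum (x>0 ∷ ps) = +-mono-≤ x>0 (length≤sum ps)

partitions-unique : ∀ n → Unique (partitions n)
partitions-unique n = Unique.filter⁺ (isPartition? n) (boundedLists-unique n n)

∈-partitions : ∀ n {xs} → xs ∈ partitions n ⇔ IsPartition n xs
∈-partitions n {xs} = mk⇔ (proj₂ ∘ ∈-filter⁻ (isPartition? n) {xs = boundedLists n n}) complete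
  where
  complete : IsPartition n xs → xs ∈ partitions n
  complete P@(_ , ps , refl) =
    ∈-filter⁺ (isPartition? n) (∈-boundedLists ps (parts≤sum xs) (length≤sum ps)) P

{-# OPTIONS --safe #-}
module Submission where

-- Appending a part 1 embeds the partitions of n into those of n + 1 and misses
-- (n + 1) and (n - 1, 2) when n ≥ 3. Hence p (n + 1) ≥ p n + 2, so H increases
-- strictly from H 3 = 0, and every positive integer that is not a value of H
-- lies strictly between two consecutive values.

open import Defs
import Data.Fin.Base as Fin
open import Data.Fin.Properties using (injective⇒≤)
open import Data.Integer.Base as ℤ using (+_; 1ℤ; _⊖_)
import Data.Integer.Properties as ℤ
open import Data.List.Base using (List; []; _∷_; [_]; _∷ʳ_; head; last; length; lookup; map)
open import Data.List.Membership.Propositional.Properties using (∈-lookup; ∈-map⁻)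
open import Data.List.Membership.Setoid.Properties using (index-injective)
open import Data.List.Properties using (length-map; ∷ʳ-injectiveˡ; ∷ʳ-injectiveʳ)
open import Data.List.Relation.Binary.Subset.Propositional using (_⊆_)
open import Data.List.Relation.Unary.All as All using (All; []; _∷_)
import Data.List.Relation.Unary.All.Properties as All
open import Data.List.Relation.Unary.AllPairs using (_∷_)
open import Data.List.Relation.Unary.Any as Any using (here; there)
open import Data.List.Relation.Unary.Linked using ([-]; _∷_)
import Data.List.Relation.Unary.Linked.Properties as Linked
open import Data.List.Relation.Unary.Unique.Propositional using (Unique)
import Data.List.Relation.Unary.Unique.Propositional.Properties as Unique
open import Data.Maybe.Relation.Binary.Connected using (Connected; just; nothing-just)
open import Data.Nat.Base using (ℕ; zero; suc; _+_; _≤_; _<_; _≥_; _>_; z≤n; s≤s; z<s)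
open import Data.Nat.ListAction.Properties using (sum-++)
open import Data.Nat.Properties
  using (≤-refl; ≤-trans; <⇒≤; ≰⇒>; _≤?_; m≤m+n; m≤n⇒m≤1+n; m≤n⇒m<n∨m≡n; <-cmp; +-comm)
open import Data.Product.Base using (Σ-syntax; _×_; _,_; proj₁; proj₂)
open import Data.Sum.Base using (inj₁; inj₂)
open import Function.Base using (_∘_)
open import Function.Bundles using (Equivalence)
open import Relation.Binary.Definitions using (tri<; tri≈; tri>)
open import Relation.Binary.PropositionalEquality
  using (_≡_; _≢_; refl; sym; trans; cong; subst; setoid)
open import Relation.Nullary using (¬_; Dec; yes; no; contradiction)
open import Relation.Unary using (_∖_; _≐_; ⋃; _⊥_)

module _ {a} {A : Set a} where

  lookup-injective : ∀ {xs : List A} → Unique xs → ∀ {i j} →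
                     lookup xs i ≡ lookup xs j → i ≡ j
  lookup-injective (_ ∷ _)  {Fin.zero}  {Fin.zero}  _  = refl
  lookup-injective (x∉ ∷ _) {Fin.zero}  {Fin.suc j} eq =
    contradiction eq (All.lookup x∉ (∈-lookup j))
  lookup-injective (x∉ ∷ _) {Fin.suc i} {Fin.zero}  eq =
    contradiction (sym eq) (All.lookup x∉ (∈-lookup i))
  lookup-injective (_ ∷ u)  {Fin.suc _} {Fin.suc _} eq =
    cong Fin.suc (lookup-injective u eq)

  -- Pigeonhole: sending each position of `xs` to a position of the same element in `ys` is
  -- injective, since `xs` has no repetitions.
  unique-⊆⇒length≤ : ∀ {xs ys : List A} → Unique xs → xs ⊆ ys → length xs ≤ length ys
  unique-⊆⇒length≤ {xs} u xs⊆ys =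
    injective⇒≤ {f = λ i → Any.index (xs⊆ys (∈-lookup {xs = xs} i))}
      (lookup-injective u ∘ index-injective (setoid A) _ _)

∷ʳ1-isPartition : ∀ {n xs} → IsPartition n xs → IsPartition (suc n) (xs ∷ʳ 1)
∷ʳ1-isPartition {n} {xs} (↘ , pos , sum≡n) =
  Linked.++⁺ ↘ (last≥1 pos) [-] ,
  All.∷ʳ⁺ pos z<s ,
  trans (sum-++ xs [ 1 ]) (trans (+-comm _ 1) (cong suc sum≡n))
  where
  last≥1 : ∀ {ys} → All (_> 0) ys → Connected _≥_ (last ys) (head [ 1 ])
  last≥1 []            = nothing-just
  last≥1 (y>0 ∷ [])    = just y>0
  last≥1 (_ ∷ z>0 ∷ p) = last≥1 (z>0 ∷ p)

2+p[n]≤p[1+n] : ∀ {n} → n ≥ 3 → 2 + p n ≤ p (suc n)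
-- Here `k` is n - 1, and n ≥ 3 becomes `2≤k`, exactly what puts the parts `k`, 2 in weakly
-- decreasing order.
2+p[n]≤p[1+n] {n@(suc k@(suc _))} (s≤s 2≤k@(s≤s _)) =
  subst (λ l → 2 + l ≤ p (suc n)) (length-map (_∷ʳ 1) (partitions n))
        (unique-⊆⇒length≤ unique ⊆-partitions)
  where
  extended : List (List ℕ)
  extended = map (_∷ʳ 1) (partitions n)

  -- Every list in `extended` ends in 1, so comparing last entries suffices.
  ∉-extended : ∀ {xs x} → x ≢ 1 → All (xs ∷ʳ x ≢_) extended
  ∉-extended {xs} x≢1 = All.map⁺ (All.universal (λ ys → x≢1 ∘ ∷ʳ-injectiveʳ xs ys) _)

  unique : Unique ([ suc n ] ∷ (k ∷ 2 ∷ []) ∷ extended)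
  unique = ((λ ()) ∷ ∉-extended {[]} λ ()) ∷ ∉-extended {[ k ]} (λ ()) ∷
           Unique.map⁺ (∷ʳ-injectiveˡ _ _) (partitions-unique n)

  ⊆-partitions : [ suc n ] ∷ (k ∷ 2 ∷ []) ∷ extended ⊆ partitions (suc n)
  ⊆-partitions (here refl)         =
    Equivalence.from (∈-partitions (suc n)) ([-] , z<s ∷ [] , +-comm (suc n) 0)
  ⊆-partitions (there (here refl)) =
    Equivalence.from (∈-partitions (suc n)) (2≤k ∷ [-] , z<s ∷ z<s ∷ [] , +-comm k 2)
  ⊆-partitions (there (there xs∈)) with _ , ys∈ , refl ← ∈-map⁻ (_∷ʳ 1) xs∈ =
    Equivalence.from (∈-partitions (suc n))
      (∷ʳ1-isPartition (Equivalence.to (∈-partitions n) ys∈))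

H[n]<H[1+n] : ∀ {n} → n ≥ 3 → H n ℤ.< H (suc n)
H[n]<H[1+n] {n} n≥3 = begin-strict
  H n                ≡⟨ ℤ.m-n≡m⊖n (p n) n ⟩
  p n ⊖ n            ≡⟨ ℤ.[1+m]⊖[1+n]≡m⊖n (p n) n ⟨
  -- Of the two extra partitions, one offsets the growth of the subtracted index and the other makes
  -- the inequality strict.
  suc (p n) ⊖ suc n  <⟨ ℤ.⊖-monoˡ-< (suc n) (2+p[n]≤p[1+n] n≥3) ⟩
  p (suc n) ⊖ suc n  ≡⟨ ℤ.m-n≡m⊖n (p (suc n)) (suc n) ⟨
  H (suc n)          ∎
  where open ℤ.≤-Reasoning

H-mono-≤ : ∀ {m n} → m ≥ 3 → m ≤ n → H m ℤ.≤ H n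
H-mono-≤ {n = zero}  _   z≤n = ℤ.≤-refl
H-mono-≤ {n = suc n} m≥3 m≤1+n with m≤n⇒m<n∨m≡n m≤1+n
... | inj₁ (s≤s m≤n) =
  ℤ.≤-trans (H-mono-≤ m≥3 m≤n) (ℤ.<⇒≤ (H[n]<H[1+n] (≤-trans m≥3 m≤n)))
... | inj₂ refl      = ℤ.≤-refl

-- Strict growth raises `H` by at least 1 per step from `H 3`, which evaluates to 0. This bounds the
-- search for the gap containing a given integer.
k≤H[3+k] : ∀ k → + k ℤ.≤ H (3 + k)
k≤H[3+k] zero    = ℤ.≤-refl
k≤H[3+k] (suc k) =
  ℤ.i<j⇒suc[i]≤j (ℤ.≤-<-trans (k≤H[3+k] k) (H[n]<H[1+n] (m≤m+n 3 k)))

between⇒gap : ∀ n {m} → H n ℤ.< m → m ℤ.< H (suc n) → gap n m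
between⇒gap n {m} Hn<m m<H =
  subst (ℤ._≤ m) (ℤ.+-comm 1ℤ (H n)) (ℤ.i<j⇒suc[i]≤j Hn<m) ,
  subst (m ℤ.≤_) (ℤ.+-comm ℤ.-1ℤ (H (suc n))) (ℤ.i<j⇒i≤pred[j] m<H)

gap⇒between : ∀ n {m} → gap n m → H n ℤ.< m × m ℤ.< H (suc n)
gap⇒between n {m} (lower , upper) =
  ℤ.suc[i]≤j⇒i<j (subst (ℤ._≤ m) (ℤ.+-comm (H n) 1ℤ) lower) ,
  ℤ.i≤pred[j]⇒i<j (subst (m ℤ.≤_) (ℤ.+-comm (H (suc n)) ℤ.-1ℤ) upper)

-- Descent on `k` to the first value of `H` that is at least `m`; the value before it is then below
-- `m`. The descent cannot reach `H 3`, which is 0.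
bounded⇒gap : ∀ {m} k → (ℤ>0 ∖ ℋ⁺) m → m ℤ.≤ H (3 + k) →
              ⋃ (Σ[ n ∈ ℕ ] n ≥ 3) (λ i → gap (proj₁ i)) m
bounded⇒gap zero (m>0 , _) m≤H = contradiction (ℤ.<-≤-trans m>0 m≤H) (ℤ.<-irrefl refl)
bounded⇒gap {m} (suc k) m∈@(_ , m∉ℋ⁺) m≤H with m ℤ.≤? H (3 + k)
... | yes m≤H′ = bounded⇒gap k m∈ m≤H′
... | no  m≰H′ = (3 + k , m≤m+n 3 k) , between⇒gap (3 + k) (ℤ.≰⇒> m≰H′)
  -- The upper bound is strict because its index is at least 4, so equality would put `m` in `ℋ⁺`.
  (ℤ.≤∧≢⇒< m≤H λ m≡H → m∉ℋ⁺ (4 + k , m≤m+n 4 k , m≡H))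

ℤ>0∖ℋ⁺⊆gaps : ∀ {m} → (ℤ>0 ∖ ℋ⁺) m → ⋃ (Σ[ n ∈ ℕ ] n ≥ 3) (λ i → gap (proj₁ i)) m
ℤ>0∖ℋ⁺⊆gaps {+ k} m∈ = bounded⇒gap k m∈ (k≤H[3+k] k)

-- Positivity follows from 0 = `H 3` ≤ `H n` < `m`. By monotonicity a value `H k` with `k` ≥ 4 is at
-- most `H n` or at least `H (suc n)`, according to whether `k` ≤ `n`.
gap⊆ℤ>0∖ℋ⁺ : ∀ n {m} → n ≥ 3 → gap n m → (ℤ>0 ∖ ℋ⁺) m
gap⊆ℤ>0∖ℋ⁺ n n≥3 m∈ with Hn<m , m<H ← gap⇒between n m∈ =
  ℤ.≤-<-trans (H-mono-≤ ≤-refl n≥3) Hn<m , λ where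
    (k , k≥4 , refl) → case (k ≤? n) k≥4 Hn<m m<H
  where
  case : ∀ {k} → Dec (k ≤ n) → k ≥ 4 → H n ℤ.< H k → ¬ H k ℤ.< H (suc n)
  case (yes k≤n) k≥4 Hn<Hk _ = ℤ.<⇒≱ Hn<Hk (H-mono-≤ (<⇒≤ k≥4) k≤n)
  case (no k≰n)  _   _ Hk<H  = ℤ.<⇒≱ Hk<H (H-mono-≤ (m≤n⇒m≤1+n n≥3) (≰⇒> k≰n))

-- A common element would give `H j` < `H (suc i)`, against monotonicity, since `suc i` ≤ `j`.
gap-disjoint-< : ∀ i j {m} → i ≥ 3 → i < j → gap i m → ¬ gap j m
gap-disjoint-< i j i≥3 i<j m∈i m∈j =
  ℤ.<⇒≱ (ℤ.<-trans (proj₁ (gap⇒between j m∈j)) (proj₂ (gap⇒between i m∈i)))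
        (H-mono-≤ (m≤n⇒m≤1+n i≥3) i<j)

theorem3p5 : (ℤ>0 ∖ ℋ⁺ ≐ ⋃ (Σ[ n ∈ ℕ ] n ≥ 3) (λ i → gap (proj₁ i))) ×
    (∀ i j → i ≥ 3 → j ≥ 3 → i ≢ j → gap i ⊥ gap j)
theorem3p5 = (ℤ>0∖ℋ⁺⊆gaps , λ ((n , n≥3) , m∈) → gap⊆ℤ>0∖ℋ⁺ n n≥3 m∈) , disjoint
  where
  disjoint : ∀ i j → i ≥ 3 → j ≥ 3 → i ≢ j → gap i ⊥ gap j
  disjoint i j i≥3 j≥3 i≢j (m∈i , m∈j) with <-cmp i j
  ... | tri< i<j _ _ = gap-disjoint-< i j i≥3 i<j m∈i m∈j
  ... | tri≈ _ i≡j _ = contradiction i≡j i≢j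
  ... | tri> _ _ j<i = gap-disjoint-< j i j≥3 j<i m∈j m∈i
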